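{- Let $n,x$ be integers with $1<x<n$, so that $G=C_{2n}(x,1,n)$ is a $5$-regular circulant graph. If $n\equiv x\equiv 0 \pmod 3$ and $x>\tfrac{2n}{3}$, then $G$ is word-representable.
   Context: Two distinct letters $x,y$ alternate in a word $w$ if, after deleting all other letters from $w$, the resulting word is of the form $xyxy\cdots$ or $yxyx\cdots$ (of even or odd length). A graph $G=(V,E)$ is word-representable if there is a word $w$ over the alphabet $V$, containing every letter of $V$ at least once, such that for all distinct $x,y\in V$, $xy\in E$ if and only if $x$ and $y$ alternate in $w$. For an integer $m$ and a set $R$ of positive integers each at most $m/2$, the circulant graph $C_m(R)$ has vertex set $\{0,1,\dots,m-1\}$, with $i$ and $j$ adjacent iff $\min(|i-j|,\,m-|i-j|)\in R$. $C_{2n}(x,1,n)$ denotes the circulant graph on $2n$ vertices with jump set $\{1,x,n\}$; it is $5$-regular exactly when $1<x<n$. -}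

module Defs where

open import Data.Fin.Base using (Fin; toℕ)
open import Data.Fin.Properties using (_≟_)
open import Data.List.Base using (List; []; _∷_; filter)
open import Data.List.Membership.Propositional using (_∈_)
open import Data.List.Relation.Unary.All as All using (All; []; _∷_)
open import Data.Nat.Base using (ℕ; _*_; _∸_; _⊓_; ∣_-_∣; _≤_; _<_)
open import Data.Nat.Properties
  using (∣-∣-comm; ∣n-n∣≡0; *-monoʳ-≤; ≤-trans; ≤-refl; <⇒≤)
open import Data.Product.Base using (_×_; _,_; proj₁; ∃-syntax)
open import Data.Sum.Base using (_⊎_)
open import Function.Bundles using (_⇔_)
open import Level using (0ℓ)
open import Relation.Binary.Core using (Rel)
open import Relation.Binary.Definitions using (Symmetric; Irreflexive)
open import Relation.Binary.PropositionalEquality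
  using (_≡_; _≢_; refl; subst; cong)
open import Relation.Nullary.Decidable using (_⊎-dec_)
open import Relation.Nullary.Negation using (¬_)

record Graph (m : ℕ) : Set₁ where
  field
    Adj    : Rel (Fin m) 0ℓ
    sym    : Symmetric Adj
    irrefl : Irreflexive _≡_ Adj

Word : ℕ → Set
Word m = List (Fin m)

restrict : ∀ {m} → Fin m → Fin m → Word m → Word m
restrict x y = filter (λ z → (z ≟ x) ⊎-dec (z ≟ y))

-- AltFrom x y u : u is a finite prefix of x y x y ⋯ (of even or odd length).
data AltFrom {m : ℕ} : Fin m → Fin m → Word m → Set where
  []  : ∀ {x y} → AltFrom x y []
  _∷_ : ∀ x {y u} → AltFrom y x u → AltFrom x y (x ∷ u)

Alternate : ∀ {m} → Fin m → Fin m → Word m → Set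
Alternate x y w = AltFrom x y (restrict x y w) ⊎ AltFrom y x (restrict x y w)

Represents : ∀ {m} → Word m → Graph m → Set
Represents {m} w G =
  (∀ (v : Fin m) → v ∈ w) ×
  (∀ (x y : Fin m) → x ≢ y → Graph.Adj G x y ⇔ Alternate x y w)

WordRepresentable : ∀ {m} → Graph m → Set
WordRepresentable {m} G = ∃[ w ] Represents w G

circDist : ∀ {m} → Fin m → Fin m → ℕ
circDist {m} i j = ∣ toℕ i - toℕ j ∣ ⊓ (m ∸ ∣ toℕ i - toℕ j ∣)

-- Lists stand for finite sets of jumps; only membership matters.
IsJumpSet : ℕ → List ℕ → Set
IsJumpSet m R = All (λ r → 1 ≤ r × 2 * r ≤ m) R

circulant : (m : ℕ) (R : List ℕ) → IsJumpSet m R → Graph m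
circulant m R R-jumps = record
  { Adj    = λ i j → circDist i j ∈ R
  ; sym    = λ {i} {j} → subst (λ d → d ⊓ (m ∸ d) ∈ R) (∣-∣-comm (toℕ i) (toℕ j))
  ; irrefl = λ { {i} refl d∈R → 0∉R (subst (_∈ R) (circDist-refl i) d∈R) }
  }
  where
  circDist-refl : ∀ (i : Fin m) → circDist i i ≡ 0
  circDist-refl i = cong (λ d → d ⊓ (m ∸ d)) (∣n-n∣≡0 (toℕ i))

  0∉R : ¬ (0 ∈ R)
  0∉R 0∈R with () ← proj₁ (All.lookup R-jumps 0∈R)

C₂ₙ[_,1,_] : (x n : ℕ) → 1 < x → x < n → Graph (2 * n)
C₂ₙ[ x ,1, n ] 1<x x<n = circulant (2 * n) (1 ∷ x ∷ n ∷ [])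
  ( (≤-refl  , *-monoʳ-≤ 2 1≤n)
  ∷ (<⇒≤ 1<x , *-monoʳ-≤ 2 (<⇒≤ x<n))
  ∷ (1≤n     , ≤-refl)
  ∷ [])
  where
  1≤n : 1 ≤ n
  1≤n = ≤-trans (<⇒≤ 1<x) (<⇒≤ x<n)

{-# OPTIONS --safe #-}

-- With B = 2n/3, the colouring i ↦ i + ⌊i/B⌋ mod 3 of 0,…,2n-1 is proper: jumps
-- x and n are multiples of 3 whose cyclic distance exceeds B, so they preserve i mod 3 and
-- change the block ⌊i/B⌋, while a jump by 1 changes the sum by 1 or 2 mod 3.
--
-- Every 3-colourable graph is word-representable: orient the edges from smaller to larger
-- colour. Words in which the restriction to each edge a → b is abab⋯ab are closed under
-- concatenation, so it suffices to give, for each vertex v, such a word in which v fails to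
-- alternate with enough of its non-neighbours. It only needs the partition of the vertices
-- by colour and by relation to v.
module Submission where

open import Defs
open import Data.Bool.Base using (Bool; true; false; if_then_else_)
import Data.Bool.Properties as Bool
import Data.Fin.Base as Fin
open import Data.Fin.Base using (Fin; toℕ)
open import Data.Fin.Patterns using (0F; 1F; 2F)
open import Data.Fin.Properties using (_≟_; all?; _<?_; <-cmp; toℕ<n; toℕ-fromℕ<)
open import Data.List.Base
  using (List; []; _∷_; [_]; _++_; filter; concatMap; map; allFin)
open import Data.List.Membership.Propositional using (_∈_; lose)
open import Data.List.Membership.Propositional.Properties
  using (∈-allFin; ∈-concatMap⁺; ∈-filter⁺; ∈-filter⁻; ∈-∃++)
import Data.List.Membership.DecPropositional as DecMembership
open import Data.List.Properties
  using (≡-dec; filter-++; filter-accept; filter-reject; filter-none; filter-≐;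
         concatMap-cong; concatMap-++; map-concatMap)
import Data.List.Relation.Unary.All as All
open import Data.List.Relation.Unary.AllPairs using (_∷_)
open import Data.List.Relation.Unary.Any using (here; there)
open import Data.List.Relation.Unary.Linked using (Linked; []; [-]; _∷_; linked?; tail)
open import Data.List.Relation.Unary.Unique.Propositional using (Unique)
import Data.List.Relation.Unary.Unique.Propositional.Properties as Unique
open import Data.Nat.Base
  using (ℕ; suc; _+_; _*_; _∸_; _⊓_; _≤_; _<_; z≤n; s≤s; s≤s⁻¹; NonZero; >-nonZero; >-nonZero⁻¹)
import Data.Nat.Properties as ℕ
open import Data.Nat.DivMod
open import Data.Nat.Divisibility
open import Data.Product.Base using (_×_; _,_; proj₁; proj₂)
open import Data.Product.Properties using () renaming (≡-dec to ×-≡-dec)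
open import Data.Sum.Base as Sum using (_⊎_; inj₁; inj₂)
open import Function.Base using (_∘_)
open import Function.Bundles using (mk⇔)
open import Level using (0ℓ)
open import Relation.Binary.Core using (Rel)
open import Relation.Binary.Definitions using (Decidable; DecidableEquality; tri<; tri≈; tri>)
open import Relation.Binary.PropositionalEquality hiding ([_])
open import Relation.Nullary
  using (¬_; yes; no; does; contradiction; ¬?; _×-dec_; _⊎-dec_; _→-dec_; toWitness; from-no)
import Relation.Unary as U

-- Filtering and adjacent distinctness in lists.

module _ {A : Set} {P : A → Set} (P? : U.Decidable P) where

  filter-concatMap : ∀ {B : Set} (g : B → List A) ys →
                     filter P? (concatMap g ys) ≡ concatMap (filter P? ∘ g) ys
  filter-concatMap g []       = refl
  filter-concatMap g (y ∷ ys) =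
    trans (filter-++ P? (g y) _) (cong (_ ++_) (filter-concatMap g ys))

  filter-singleton : ∀ {x xs} → Unique xs → x ∈ xs → P x →
                     (∀ {z} → z ∈ xs → P z → z ≡ x) → filter P? xs ≡ [ x ]
  filter-singleton (x∉ ∷ _) (here refl) px only =
    trans (filter-accept P? px)
          (cong (_ ∷_) (filter-none P?
            (All.tabulate λ z∈ pz → All.lookup x∉ z∈ (sym (only (there z∈) pz)))))
  filter-singleton (y∉ ∷ u) (there x∈) px only =
    trans (filter-reject P? λ py → All.lookup y∉ x∈ (only (here refl) py))
          (filter-singleton u x∈ px (only ∘ there))

module _ {A : Set} {R : Rel A 0ℓ} where

  Linked-++⁻ʳ : ∀ xs {ys} → Linked R (xs ++ ys) → Linked R ys
  Linked-++⁻ʳ []       l = l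
  Linked-++⁻ʳ (x ∷ xs) l = Linked-++⁻ʳ xs (tail l)

  Linked-++⁻ˡ : ∀ xs {ys} → Linked R (xs ++ ys) → Linked R xs
  Linked-++⁻ˡ []           _       = []
  Linked-++⁻ˡ (x ∷ [])     _       = [-]
  Linked-++⁻ˡ (x ∷ y ∷ xs) (r ∷ l) = r ∷ Linked-++⁻ˡ (y ∷ xs) l

Linked-≢-map⁻ : ∀ {A B : Set} (f : A → B) xs → Linked _≢_ (map f xs) → Linked _≢_ xs
Linked-≢-map⁻ f []           _       = []
Linked-≢-map⁻ f (x ∷ [])     _       = [-]
Linked-≢-map⁻ f (x ∷ y ∷ xs) (r ∷ l) = (r ∘ cong f) ∷ Linked-≢-map⁻ f (y ∷ xs) l

-- Alternation of two letters.

module _ {m : ℕ} where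

  -- Used to refute alternation by a doubled letter: `Linked _≢_` passes to contiguous factors,
  -- whichever letter they start with.
  AltFrom⇒Linked-≢ : ∀ {x y : Fin m} {u} → x ≢ y → AltFrom x y u → Linked _≢_ u
  AltFrom⇒Linked-≢ _   []                   = []
  AltFrom⇒Linked-≢ _   (_ ∷ [])             = [-]
  AltFrom⇒Linked-≢ x≢y (_ ∷ alt@(_ ∷ _))    = x≢y ∷ AltFrom⇒Linked-≢ (x≢y ∘ sym) alt

  Alternate⇒Linked-≢ : ∀ {x y : Fin m} w → x ≢ y → Alternate x y w →
                       Linked _≢_ (restrict x y w)
  Alternate⇒Linked-≢ w x≢y (inj₁ alt) = AltFrom⇒Linked-≢ x≢y alt
  Alternate⇒Linked-≢ w x≢y (inj₂ alt) = AltFrom⇒Linked-≢ (x≢y ∘ sym) alt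

  Alternate-sym : ∀ {x y : Fin m} w → Alternate x y w → Alternate y x w
  Alternate-sym {x} {y} w = Sum.swap ∘ subst (λ u → AltFrom x y u ⊎ AltFrom y x u)
    (filter-≐ _ _ (Sum.swap , Sum.swap) w)

-- The block around a vertex, reduced to finitely many classes.

Class : Set
Class = Fin 3 × Fin 3

-- Roles relative to a fixed vertex `v`; a `Class` is a colour followed by a role.
pattern self = 0F
pattern nbr  = 1F
pattern non  = 2F

_≟ᶜ_ : DecidableEquality Class
_≟ᶜ_ = ×-≡-dec _≟_ _≟_

-- The first two lists are linear extensions of the orientation with self last,
-- respectively first, among the non-neighbours of its own colour and of the colour
-- just below. This cannot separate colours 0 and 2, because of paths through colour 1;
-- the third list instead puts both copies of a self of colour 0 before all its
-- non-neighbours of colour 2.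
selfLate selfEarly selfTwice schedule : List Class
selfLate =
  (0F , nbr) ∷ (0F , non) ∷ (0F , self) ∷
  (1F , nbr) ∷ (1F , non) ∷ (1F , self) ∷
  (2F , nbr) ∷ (2F , non) ∷ (2F , self) ∷ []
selfEarly =
  (0F , self) ∷ (0F , nbr) ∷ (1F , self) ∷
  (0F , non) ∷ (1F , nbr) ∷ (2F , self) ∷
  (1F , non) ∷ (2F , nbr) ∷ (2F , non) ∷ []
selfTwice =
  (0F , self) ∷ (0F , nbr) ∷ (0F , non) ∷
  (1F , self) ∷ (1F , nbr) ∷ (1F , non) ∷
  (2F , self) ∷ (2F , nbr) ∷
  (0F , self) ∷
  (2F , non) ∷
  (0F , nbr) ∷ (0F , non) ∷
  (1F , self) ∷ (1F , nbr) ∷ (1F , non) ∷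
  (2F , self) ∷ (2F , nbr) ∷ (2F , non) ∷ []
schedule = selfLate ++ selfEarly ++ selfTwice

-- Boolean model of restricting to two vertices: `true` stands for the one of class `k`, `false` for
-- the one of class `l`. Alternation thus becomes a finite computation, independent of the graph.
letter : Class → Class → Class → List Bool
letter k l c = if does (c ≟ᶜ k) then [ true ] else if does (c ≟ᶜ l) then [ false ] else []

trace : Class → Class → List Bool
trace k l = concatMap (letter k l) schedule

-- What an edge forces on the roles of its ends: it cannot join `v` to a non-neighbour of `v`.
Consistent : Fin 3 → Fin 3 → Set
Consistent r s = ¬ (r ≡ self × s ≡ non) × ¬ (r ≡ non × s ≡ self)

-- Checked by evaluation. Each class occurs once in `selfLate`, once in `selfEarly` and twice in
-- `selfTwice`, hence four pairs.
trace-edge : ∀ i j r s → i Fin.< j → Consistent r s →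
  trace (i , r) (j , s) ≡ true ∷ false ∷ true ∷ false ∷ true ∷ false ∷ true ∷ false ∷ []
trace-edge = toWitness {a? =
  all? λ i → all? λ j → all? λ r → all? λ s → (i <? j) →-dec
    ((¬? ((r ≟ self) ×-dec (s ≟ non)) ×-dec ¬? ((r ≟ non) ×-dec (s ≟ self))) →-dec
      ≡-dec Bool._≟_ (trace (i , r) (j , s)) _)} _

-- The disjunction chooses the end that plays `self`. For equal or consecutive colours an end of
-- larger colour works: its letter is doubled where `selfLate` meets `selfEarly`. For colours 0 and
-- 2 the end of colour 0 works, doubled within `selfTwice`.
trace-nonedge : ∀ i j → ¬ Linked _≢_ (trace (i , self) (j , non))
                      ⊎ ¬ Linked _≢_ (trace (j , self) (i , non))
trace-nonedge = toWitness {a? =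
  all? λ i → all? λ j → ¬? (linked? _≢?_ _) ⊎-dec ¬? (linked? _≢?_ _)} _
  where
  _≢?_ : Decidable (_≢_ {A = Bool})
  s ≢? t = ¬? (s Bool.≟ t)

self∈schedule : ∀ i → (i , self) ∈ schedule
self∈schedule = toWitness {a? = all? λ i → (i , self) ∈? schedule} _
  where open DecMembership _≟ᶜ_ using (_∈?_)

-- Word-representability of 3-colourable graphs.

module _ {m : ℕ} (G : Graph m) (adj? : Decidable (Graph.Adj G)) (colour : Fin m → Fin 3)
         (proper : ∀ {x y} → Graph.Adj G x y → colour x ≢ colour y) where

  open Graph G using (Adj)

  private

    role : Fin m → Fin m → Fin 3
    role v u with u ≟ v | adj? v u
    ... | yes _ | _     = self
    ... | no _  | yes _ = nbr
    ... | no _  | no _  = non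

    role-self : ∀ v → role v v ≡ self
    role-self v with v ≟ v
    ... | yes _  = refl
    ... | no v≢v = contradiction refl v≢v

    role-non : ∀ {v u} → u ≢ v → ¬ Adj v u → role v u ≡ non
    role-non {v} {u} u≢v ¬vu with u ≟ v | adj? v u
    ... | yes u≡v | _      = contradiction u≡v u≢v
    ... | no _    | yes vu = contradiction vu ¬vu
    ... | no _    | no _   = refl

    role-self⁻ : ∀ {v u} → role v u ≡ self → u ≡ v
    role-self⁻ {v} {u} eq with u ≟ v | adj? v u
    role-self⁻ _  | yes u≡v | _     = u≡v
    role-self⁻ () | no _    | yes _
    role-self⁻ () | no _    | no _

    role-non⁻ : ∀ {v u} → role v u ≡ non → ¬ Adj v u
    role-non⁻ {v} {u} eq with u ≟ v | adj? v u
    role-non⁻ () | yes _ | _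
    role-non⁻ () | no _  | yes _
    role-non⁻ _  | no _  | no ¬vu = ¬vu

    role-consistent : ∀ v {x y} → Adj x y → Consistent (role v x) (role v y)
    role-consistent v {x} {y} xy =
        (λ (x-self , y-non) → role-non⁻ y-non (subst (λ z → Adj z y) (role-self⁻ x-self) xy))
      , (λ (x-non , y-self) → role-non⁻ x-non
          (Graph.sym G (subst (Adj x) (role-self⁻ y-self) xy)))

    class : Fin m → Fin m → Class
    class v u = colour u , role v u

    -- A cell is monochromatic, hence independent, so the order of its vertices is immaterial to the
    -- proof.
    cell : Fin m → Class → Word m
    cell v k = filter (λ u → class v u ≟ᶜ k) (allFin m)

    ∈-cell : ∀ {v k z} → z ∈ cell v k → class v z ≡ k
    ∈-cell z∈ = proj₂ (∈-filter⁻ _ {xs = allFin m} z∈)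

    local : Fin m → Word m
    local v = concatMap (cell v) schedule

    word : Word m
    word = concatMap local (allFin m)

    choose : Fin m → Fin m → Bool → Fin m
    choose x y t = if t then x else y

    -- A cell lists each vertex of its class exactly once, and distinct classes keep `x` and `y` out
    -- of a common cell, so at most one letter survives.
    restrict-cell : ∀ v {x y} → class v x ≢ class v y → ∀ k →
      restrict x y (cell v k) ≡ map (choose x y) (letter (class v x) (class v y) k)
    restrict-cell v {x} {y} kx≢ky k with k ≟ᶜ class v x
    ... | yes refl = filter-singleton _ (Unique.filter⁺ _ (Unique.allFin⁺ m))
          (∈-filter⁺ _ (∈-allFin x) refl) (inj₁ refl)
          λ where _  (inj₁ z≡x)  → z≡x
                  z∈ (inj₂ refl) → contradiction (sym (∈-cell z∈)) kx≢ky
    ... | no k≢kx with k ≟ᶜ class v y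
    ... | yes refl = filter-singleton _ (Unique.filter⁺ _ (Unique.allFin⁺ m))
          (∈-filter⁺ _ (∈-allFin y) refl) (inj₂ refl)
          λ where z∈ (inj₁ refl) → contradiction (∈-cell z∈) kx≢ky
                  _  (inj₂ z≡y)  → z≡y
    ... | no k≢ky = filter-none (λ z → (z ≟ x) ⊎-dec (z ≟ y)) (All.tabulate λ where
          z∈ (inj₁ refl) → k≢kx (sym (∈-cell z∈))
          z∈ (inj₂ refl) → k≢ky (sym (∈-cell z∈)))

    restrict-local : ∀ v {x y} → class v x ≢ class v y →
      restrict x y (local v) ≡ map (choose x y) (trace (class v x) (class v y))
    restrict-local v {x} {y} kx≢ky = begin
      restrict x y (concatMap (cell v) schedule)
        ≡⟨ filter-concatMap _ (cell v) schedule ⟩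
      concatMap (restrict x y ∘ cell v) schedule
        ≡⟨ concatMap-cong (restrict-cell v kx≢ky) schedule ⟩
      concatMap (map (choose x y) ∘ letter (class v x) (class v y)) schedule
        ≡⟨ map-concatMap (choose x y) (letter (class v x) (class v y)) schedule ⟨
      map (choose x y) (trace (class v x) (class v y)) ∎
      where open ≡-Reasoning

    covers : ∀ v → v ∈ word
    covers v = ∈-concatMap⁺ local (lose (∈-allFin v)
      (∈-concatMap⁺ (cell v) (lose (self∈schedule (colour v))
        (∈-filter⁺ _ (∈-allFin v) (cong (colour v ,_) (role-self v))))))

    edge⇒AltFrom : ∀ {x y} → Adj x y → colour x Fin.< colour y → AltFrom x y (restrict x y word)
    edge⇒AltFrom {x} {y} xy cx<cy =
      subst (AltFrom x y) (sym restrict-word) (alternating (allFin m))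
      where
      xyxyxyxy : Word m
      xyxyxyxy = x ∷ y ∷ x ∷ y ∷ x ∷ y ∷ x ∷ y ∷ []

      -- Every `local v` contributes the same block, whatever the roles of `x` and `y`; it starts
      -- with `x` and ends with `y`, so the blocks join into an alternating word.
      restrict-word : restrict x y word ≡ concatMap (λ _ → xyxyxyxy) (allFin m)
      restrict-word = trans (filter-concatMap _ local (allFin m))
        (concatMap-cong (λ v → trans
          (restrict-local v (proper xy ∘ cong proj₁))
          (cong (map (choose x y)) (trace-edge _ _ _ _ cx<cy (role-consistent v xy)))) (allFin m))

      alternating : ∀ (vs : Word m) → AltFrom x y (concatMap (λ _ → xyxyxyxy) vs)
      alternating []       = []
      alternating (_ ∷ vs) = x ∷ y ∷ x ∷ y ∷ x ∷ y ∷ x ∷ y ∷ alternating vs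

    edge⇒Alternate : ∀ {x y} → Adj x y → Alternate x y word
    edge⇒Alternate {x} {y} xy with <-cmp (colour x) (colour y)
    ... | tri< cx<cy _ _ = inj₁ (edge⇒AltFrom xy cx<cy)
    ... | tri≈ _ cx≡cy _ = contradiction cx≡cy (proper xy)
    ... | tri> _ _ cy<cx = Alternate-sym word (inj₁ (edge⇒AltFrom (Graph.sym G xy) cy<cx))

    -- `local v` is a contiguous factor of `word`, so a doubled letter in its trace would survive in
    -- the whole restriction.
    Alternate⇒Linked-trace : ∀ {v y} → v ≢ y → ¬ Adj v y → Alternate v y word →
      Linked _≢_ (trace (colour v , self) (colour y , non))
    Alternate⇒Linked-trace {v} {y} v≢y ¬vy alt with ∈-∃++ (∈-allFin v)
    ... | us , us′ , allFin≡ =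
      subst₂ (λ r s → Linked _≢_ (trace (colour v , r) (colour y , s)))
        (role-self v) y-non
        (Linked-≢-map⁻ (choose v y) _
          (subst (Linked _≢_) (restrict-local v classes≢)
            (Linked-++⁻ˡ (restrict v y (local v))
              (Linked-++⁻ʳ (restrict v y (concatMap local us))
                (subst (Linked _≢_) split (Alternate⇒Linked-≢ word v≢y alt))))))
      where
      y-non : role v y ≡ non
      y-non = role-non (v≢y ∘ sym) ¬vy

      -- The colours may agree; the roles differ, since only `v` has role `self`.
      classes≢ : class v v ≢ class v y
      classes≢ eq = v≢y (sym (role-self⁻ (trans (sym (cong proj₂ eq)) (role-self v))))

      split : restrict v y word ≡
        restrict v y (concatMap local us) ++ restrict v y (local v) ++ restrict v y (concatMap local us′)
      split = begin
        restrict v y word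
          ≡⟨ cong (restrict v y ∘ concatMap local) allFin≡ ⟩
        restrict v y (concatMap local (us ++ v ∷ us′))
          ≡⟨ cong (restrict v y) (concatMap-++ local us (v ∷ us′)) ⟩
        restrict v y (concatMap local us ++ local v ++ concatMap local us′)
          ≡⟨ filter-++ _ (concatMap local us) _ ⟩
        restrict v y (concatMap local us) ++ restrict v y (local v ++ concatMap local us′)
          ≡⟨ cong (_ ++_) (filter-++ _ (local v) _) ⟩
        _ ∎
        where open ≡-Reasoning

    Alternate⇒edge : ∀ {x y} → x ≢ y → Alternate x y word → Adj x y
    Alternate⇒edge {x} {y} x≢y alt with adj? x y
    ... | yes xy = xy
    ... | no ¬xy with trace-nonedge (colour x) (colour y)
    ... | inj₁ broken = contradiction (Alternate⇒Linked-trace x≢y ¬xy alt) broken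
    ... | inj₂ broken = contradiction
          (Alternate⇒Linked-trace (x≢y ∘ sym) (¬xy ∘ Graph.sym G) (Alternate-sym word alt)) broken

  3-colourable⇒WordRepresentable : WordRepresentable G
  3-colourable⇒WordRepresentable =
    word , covers , λ x y x≢y → mk⇔ edge⇒Alternate (Alternate⇒edge x≢y)

-- Arithmetic of the block colouring.

[m+n]%o≡m%o⇒o∣n : ∀ m n o .{{_ : NonZero o}} → (m + n) % o ≡ m % o → o ∣ n
[m+n]%o≡m%o⇒o∣n m n o eq = ∣m+n∣m⇒∣n (divides ((m + n) / o) quotients) (n∣m*n (m / o))
  where
  open ≡-Reasoning
  quotients : m / o * o + n ≡ (m + n) / o * o
  quotients = ℕ.+-cancelˡ-≡ (m % o) _ _ (begin
    m % o + (m / o * o + n)           ≡⟨ ℕ.+-assoc (m % o) _ n ⟨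
    m % o + m / o * o + n             ≡⟨ cong (_+ n) (m≡m%n+[m/n]*n m o) ⟨
    m + n                             ≡⟨ m≡m%n+[m/n]*n (m + n) o ⟩
    (m + n) % o + (m + n) / o * o     ≡⟨ cong (_+ (m + n) / o * o) eq ⟩
    m % o + (m + n) / o * o           ∎)

≤∧≤suc⇒≡∨≡suc : ∀ {q r} → q ≤ r → r ≤ suc q → r ≡ q ⊎ r ≡ suc q
≤∧≤suc⇒≡∨≡suc q≤r r≤1+q with ℕ.m≤n⇒m<n∨m≡n q≤r
... | inj₁ q<r = inj₂ (ℕ.≤-antisym r≤1+q q<r)
... | inj₂ q≡r = inj₁ (sym q≡r)

module _ (B : ℕ) .{{_ : NonZero B}} where

  hue : ℕ → ℕ
  hue a = a + a / B

  private

    [a+kB]/B : ∀ a k → (a + k * B) / B ≡ k + a / B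
    [a+kB]/B a k = begin
      (a + k * B) / B     ≡⟨ +-distrib-/-∣ʳ a (n∣m*n k) ⟩
      a / B + k * B / B   ≡⟨ cong (a / B +_) (m*n/n≡m k B) ⟩
      a / B + k           ≡⟨ ℕ.+-comm (a / B) k ⟩
      k + a / B           ∎
      where open ≡-Reasoning

    -- Advancing by `d` across `e` block boundaries raises the hue by exactly `d + e`.
    hue-shift : ∀ a d e → (a + d) / B ≡ e + a / B → ¬ 3 ∣ d + e → hue (a + d) % 3 ≢ hue a % 3
    hue-shift a d e eq 3∤ same = 3∤ ([m+n]%o≡m%o⇒o∣n (hue a) (d + e) 3
      (trans (cong (_% 3) (sym rearranged)) same))
      where
      open ≡-Reasoning
      rearranged : hue (a + d) ≡ hue a + (d + e)
      rearranged = begin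
        a + d + (a + d) / B   ≡⟨ cong (a + d +_) (trans eq (ℕ.+-comm e _)) ⟩
        a + d + (a / B + e)   ≡⟨ interchange a d (a / B) e ⟩
        a + a / B + (d + e)   ∎
        where open import Algebra.Properties.CommutativeSemigroup ℕ.+-commutativeSemigroup using (interchange)

  hue-1 : ∀ a → hue (a + 1) % 3 ≢ hue a % 3
  hue-1 a with ≤∧≤suc⇒≡∨≡suc (/-monoˡ-≤ B (ℕ.m≤m+n a 1)) upper
    where
    upper : (a + 1) / B ≤ suc (a / B)
    upper = subst ((a + 1) / B ≤_) ([a+kB]/B a 1)
      (/-monoˡ-≤ B (ℕ.+-monoʳ-≤ a (subst (1 ≤_) (sym (ℕ.*-identityˡ B)) (>-nonZero⁻¹ B))))
  ... | inj₁ eq = hue-shift a 1 0 eq (from-no (3 ∣? 1))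
  ... | inj₂ eq = hue-shift a 1 1 eq (from-no (3 ∣? 2))

  -- Such a shift advances the block index by 1 or 2, while `d` itself vanishes mod 3.
  hue-long : ∀ a {d} → 3 ∣ d → 1 * B ≤ d → d ≤ 2 * B → hue (a + d) % 3 ≢ hue a % 3
  hue-long a {d} 3∣d B≤d d≤2B with ≤∧≤suc⇒≡∨≡suc
    (subst (_≤ (a + d) / B) ([a+kB]/B a 1) (/-monoˡ-≤ B (ℕ.+-monoʳ-≤ a B≤d)))
    (subst ((a + d) / B ≤_) ([a+kB]/B a 2) (/-monoˡ-≤ B (ℕ.+-monoʳ-≤ a d≤2B)))
  ... | inj₁ eq = hue-shift a d 1 eq λ 3∣ → from-no (3 ∣? 1) (∣m+n∣m⇒∣n 3∣ 3∣d)
  ... | inj₂ eq = hue-shift a d 2 eq λ 3∣ → from-no (3 ∣? 2) (∣m+n∣m⇒∣n 3∣ 3∣d)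

  -- The edge from the last vertex back to 0: `d` lies in block 2, so the hue rises by
  -- `d + 2 = 3 * B + 1`.
  hue-wrap : ∀ {d} → d + 1 ≡ 3 * B → hue d % 3 ≢ hue 0 % 3
  hue-wrap {d} d+1≡3B = hue-shift 0 d 2 (trans d/B≡2 (cong (2 +_) (sym (m<n⇒m/n≡0 (>-nonZero⁻¹ B)))))
    λ 3∣d+2 → from-no (3 ∣? 1) (∣m+n∣m⇒∣n (subst (3 ∣_) (sym (ℕ.+-assoc d 1 1)) 3∣d+2)
      (subst (3 ∣_) (sym d+1≡3B) (m∣m*n B)))
    where
    d<3B : d < 3 * B
    d<3B = subst (d <_) d+1≡3B (subst (d <_) (ℕ.+-comm 1 d) ℕ.≤-refl)
    2B≤d : 2 * B ≤ d
    2B≤d = ℕ.+-cancelˡ-≤ 1 _ _ (subst (1 + 2 * B ≤_) (trans (sym d+1≡3B) (ℕ.+-comm d 1))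
      (ℕ.+-monoˡ-≤ (2 * B) (>-nonZero⁻¹ B)))
    d/B≡2 : d / B ≡ 2
    d/B≡2 = ℕ.≤-antisym (s≤s⁻¹ (m<n*o⇒m/o<n d<3B))
      (subst (_≤ d / B) (m*n/n≡m 2 B) (/-monoˡ-≤ B 2B≤d))

⊓-complement : ∀ {d N r} → d ≤ N → d ⊓ (N ∸ d) ≡ r → d ≡ r ⊎ d + r ≡ N
⊓-complement {d} {N} d≤N eq with ℕ.⊓-sel d (N ∸ d)
... | inj₁ d⊓≡d = inj₁ (trans (sym d⊓≡d) eq)
... | inj₂ d⊓≡N∸d = inj₂ (trans (cong (d +_) (trans (sym eq) d⊓≡N∸d)) (ℕ.m+[n∸m]≡n d≤N))

-- Properness of the colouring on the circulant graph, with `n = k * 3`.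

module _ (k x : ℕ) .{{_ : NonZero (2 * k)}} where

  private
    B = 2 * k
    N = 2 * (k * 3)

    N≡3B : N ≡ 3 * B
    N≡3B = trans (sym (ℕ.*-assoc 2 k 3)) (ℕ.*-comm (2 * k) 3)

    B≤3k : B ≤ k * 3
    B≤3k = subst (B ≤_) (ℕ.*-comm 3 k) (ℕ.*-monoˡ-≤ k {2} {3} (s≤s (s≤s z≤n)))

    3k≤2B : k * 3 ≤ 2 * B
    3k≤2B = subst₂ _≤_ (ℕ.*-comm 3 k) (ℕ.*-assoc 2 2 k)
      (ℕ.*-monoˡ-≤ k {3} {4} (s≤s (s≤s (s≤s z≤n))))

    -- Since `N = 3 * B` is a multiple of 3, both `r` and `N ∸ r` are multiples of 3 between `B` and
    -- `2 * B`, so `hue-long` covers either way round the circle.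
    hue-jump : ∀ a {d r} → 3 ∣ r → B ≤ r → r ≤ k * 3 → d ≡ r ⊎ d + r ≡ N →
               hue B (a + d) % 3 ≢ hue B a % 3
    hue-jump a {r = r} 3∣r B≤r r≤3k (inj₁ refl) =
      hue-long B a 3∣r (subst (_≤ r) (sym (ℕ.*-identityˡ B)) B≤r) (ℕ.≤-trans r≤3k 3k≤2B)
    hue-jump a {d} {r} 3∣r B≤r r≤3k (inj₂ d+r≡N) = hue-long B a
      (∣m+n∣m⇒∣n (subst (3 ∣_) (sym (trans (ℕ.+-comm r d) d+r≡N)) (∣n⇒∣m*n 2 (n∣m*n k))) 3∣r)
      (subst (_≤ d) (sym (ℕ.*-identityˡ B)) (ℕ.≤-trans B≤3k 3k≤d)) d≤2B
      where
      3k≤d : k * 3 ≤ d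
      3k≤d = ℕ.+-cancelʳ-≤ (k * 3) _ _ (begin
        k * 3 + k * 3   ≡⟨ cong (k * 3 +_) (ℕ.+-identityʳ (k * 3)) ⟨
        N               ≡⟨ d+r≡N ⟨
        d + r           ≤⟨ ℕ.+-monoʳ-≤ d r≤3k ⟩
        d + k * 3       ∎)
        where open ℕ.≤-Reasoning
      d≤2B : d ≤ 2 * B
      d≤2B = ℕ.+-cancelˡ-≤ B _ _ (begin
        B + d       ≤⟨ ℕ.+-monoˡ-≤ d B≤r ⟩
        r + d       ≡⟨ ℕ.+-comm r d ⟩
        d + r       ≡⟨ d+r≡N ⟩
        N           ≡⟨ N≡3B ⟩
        B + 2 * B   ∎)
        where open ℕ.≤-Reasoning

  module _ (3∣x : 3 ∣ x) (B≤x : 2 * k ≤ x) (x<3k : x < k * 3) where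

    private

      hue-adjacent : ∀ a d → a + d < N → d ⊓ (N ∸ d) ∈ 1 ∷ x ∷ k * 3 ∷ [] →
                     hue B (a + d) % 3 ≢ hue B a % 3
      hue-adjacent a d a+d<N (here dist≡1)
        with ⊓-complement (ℕ.<⇒≤ (ℕ.≤-<-trans (ℕ.m≤n+m d a) a+d<N)) dist≡1
      ... | inj₁ refl  = hue-1 B a
      -- Here `a + d < N` forces `a = 0`, leaving only the wrap-around edge.
      ... | inj₂ d+1≡N with a
      ...   | 0     = hue-wrap B (trans d+1≡N N≡3B)
      ...   | suc b = contradiction a+d<N (ℕ.≤⇒≯ (begin
        N           ≡⟨ d+1≡N ⟨
        d + 1       ≡⟨ ℕ.+-comm d 1 ⟩
        1 + d       ≤⟨ ℕ.+-monoˡ-≤ d (s≤s z≤n) ⟩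
        suc b + d   ∎))
        where open ℕ.≤-Reasoning
      hue-adjacent a d a+d<N (there (here dist≡x)) = hue-jump a 3∣x B≤x (ℕ.<⇒≤ x<3k)
        (⊓-complement (ℕ.<⇒≤ (ℕ.≤-<-trans (ℕ.m≤n+m d a) a+d<N)) dist≡x)
      hue-adjacent a d a+d<N (there (there (here dist≡3k))) = hue-jump a (n∣m*n k) B≤3k ℕ.≤-refl
        (⊓-complement (ℕ.<⇒≤ (ℕ.≤-<-trans (ℕ.m≤n+m d a) a+d<N)) dist≡3k)

      hue-proper-≤ : ∀ {i j : Fin N} → toℕ i ≤ toℕ j → circDist i j ∈ 1 ∷ x ∷ k * 3 ∷ [] →
                     hue B (toℕ j) % 3 ≢ hue B (toℕ i) % 3
      -- Abstracting both values lets `toℕ j` become `a + d`, so that the absolute difference is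
      -- `d`.
      hue-proper-≤ {i} {j} i≤j adj with toℕ i | toℕ j | toℕ<n j | ℕ.m≤n⇒∃[o]m+o≡n i≤j
      ... | a | _ | b<N | d , refl =
        hue-adjacent a d b<N (subst (λ d → d ⊓ (N ∸ d) ∈ _) (ℕ.∣m-m+n∣≡n a d) adj)

    hue-proper : ∀ {i j : Fin N} → circDist i j ∈ 1 ∷ x ∷ k * 3 ∷ [] →
                 hue B (toℕ i) mod 3 ≢ hue B (toℕ j) mod 3
    hue-proper {i} {j} adj same with ℕ.≤-total (toℕ i) (toℕ j)
    ... | inj₁ i≤j = hue-proper-≤ i≤j adj (sym hues≡)
      where hues≡ = trans (sym (toℕ-fromℕ< _)) (trans (cong toℕ same) (toℕ-fromℕ< _))
    ... | inj₂ j≤i = hue-proper-≤ j≤i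
            (subst (λ d → d ⊓ (N ∸ d) ∈ _) (ℕ.∣-∣-comm (toℕ i) (toℕ j)) adj)
            (trans (sym (toℕ-fromℕ< _)) (trans (cong toℕ same) (toℕ-fromℕ< _)))

theorem22 : (n x : ℕ) (1<x : 1 < x) (x<n : x < n) →
    3 ∣ n → 3 ∣ x → 2 * n < 3 * x →
    WordRepresentable (C₂ₙ[ x ,1, n ] 1<x x<n)
theorem22 .(k * 3) x 1<x x<n (divides k refl) 3∣x 2n<3x =
  3-colourable⇒WordRepresentable (C₂ₙ[ x ,1, k * 3 ] 1<x x<n)
    (λ i j → circDist i j ∈? 1 ∷ x ∷ k * 3 ∷ [])
    (λ i → hue (2 * k) (toℕ i) mod 3) (λ {i} {j} → hue-proper k x 3∣x (ℕ.<⇒≤ B<x) x<n {i} {j})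
  where
  open DecMembership ℕ._≟_ using (_∈?_)

  -- The hypothesis reads `3 * (2 * k) < 3 * x`: the jump `x` exceeds the block length.
  B<x : 2 * k < x
  B<x = ℕ.*-cancelˡ-< 3 _ _
    (subst (_< 3 * x) (trans (sym (ℕ.*-assoc 2 k 3)) (ℕ.*-comm (2 * k) 3)) 2n<3x)

  instance
    2k≢0 : NonZero (2 * k)
    2k≢0 = ℕ.m*n≢0 2 k {{_}} {{ℕ.m*n≢0⇒m≢0 k {3}
      {{>-nonZero (ℕ.<-trans (ℕ.<-trans (s≤s z≤n) 1<x) x<n)}}}}
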